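{- Let $a_0,a_1,\alpha,\beta,u,v\in\mathbb{R}$ with $\alpha\beta\neq 0$, $uv\neq 0$ and $|a_0|+|a_1|\neq 0$, and let $(a_{n,k})_{0\le k\le n}$ be the binary binomial interpolated triangle with parameters $(a_0,a_1,\alpha,\beta;u,v)$. Put $\mathcal{B}=u^2\beta-uv\alpha-v^2$. Let $\ell\in\mathbb{Z}$, and let $k_0=0$ if $\ell\ge 0$ and $k_0=|\ell|$ if $\ell<0$. Then the sequence $c_k=a_{2k+\ell,k}$ ($k\ge k_0$) satisfies the binary homogeneous recurrence relation (the same for all $\ell$) $$c_{k+2}=(\alpha^2u+\alpha v+2\beta u)\,c_{k+1}-\beta\mathcal{B}\,c_{k}\qquad\text{for all } k\ge k_0.$$
   Context: The binary binomial interpolated triangle with parameters $(a_0,a_1,\alpha,\beta;u,v)$ is the array of real numbers $a_{n,k}$ ($0\le k\le n$) defined as follows. Its left diagonal is $a_{n,0}=a_n$, where $(a_n)_{n\ge0}$ has initial values $a_0,a_1$ and satisfies $a_n=\alpha a_{n-1}+\beta a_{n-2}$ for $n\ge 2$. The other entries are given by $a_{n,k}=u\,a_{n,k-1}+v\,a_{n-1,k-1}$ for $1\le k\le n$. -}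

module Defs where

open import Data.Nat.Base as ℕ using (ℕ; zero; suc)
import Data.Nat.Properties as ℕ
open import Data.Integer.Base as ℤ using (ℤ; -[1+_])
import Data.Integer.Properties as ℤ
open import Data.Rational.Base as ℚ using (ℚ; 0ℚ; 1ℚ; ½)
import Data.Rational.Properties as ℚ
open import Data.Rational.Solver using (module +-*-Solver)
open import Data.Product.Base using (∃-syntax; _×_; _,_)
open import Data.Sum.Base using (inj₁; inj₂)
open import Relation.Binary.PropositionalEquality
  using (_≡_; refl; sym; trans; cong; cong₂; subst)

private
  dist : ℚ → ℚ → ℚ
  dist p q = ℚ.∣ p ℚ.- q ∣

-- The reals as Cauchy sequences of rationals; equality is _≈_, "the
-- difference tends to 0", not _≡_.

Cauchy : (ℕ → ℚ) → Set
Cauchy x = ∀ ε → 0ℚ ℚ.< ε →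
  ∃[ N ] (∀ m n → N ℕ.≤ m → N ℕ.≤ n → ℚ.∣ x m ℚ.- x n ∣ ℚ.< ε)

record ℝ : Set where
  constructor mkℝ
  field
    seq    : ℕ → ℚ
    cauchy : Cauchy seq

open ℝ public

infix 4 _≈_

_≈_ : ℝ → ℝ → Set
x ≈ y = ∀ ε → 0ℚ ℚ.< ε →
  ∃[ N ] (∀ n → N ℕ.≤ n → ℚ.∣ seq x n ℚ.- seq y n ∣ ℚ.< ε)

private
  module Cauchyness where
    open ℚ.≤-Reasoning

    const-cauchy : ∀ q → Cauchy (λ _ → q)
    const-cauchy q ε ε>0 = 0 , λ _ _ _ _ →
      subst (ℚ._< ε) (sym (cong ℚ.∣_∣ (ℚ.+-inverseʳ q))) ε>0

    halves : ∀ ε → ½ ℚ.* ε ℚ.+ ½ ℚ.* ε ≡ ε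
    halves ε = trans (sym (ℚ.*-distribʳ-+ ε ½ ½)) (ℚ.*-identityˡ ε)

    ½-pos : ∀ ε → 0ℚ ℚ.< ε → 0ℚ ℚ.< ½ ℚ.* ε
    ½-pos ε ε>0 = ℚ.*-monoʳ-<-pos ½ ε>0

    dist-+ : ∀ a b c d →
      dist (a ℚ.+ b) (c ℚ.+ d) ℚ.≤ dist a c ℚ.+ dist b d
    dist-+ a b c d = begin
      dist (a ℚ.+ b) (c ℚ.+ d)              ≡⟨ cong ℚ.∣_∣ eq ⟩
      ℚ.∣ (a ℚ.- c) ℚ.+ (b ℚ.- d) ∣         ≤⟨ ℚ.∣p+q∣≤∣p∣+∣q∣ (a ℚ.- c) (b ℚ.- d) ⟩
      dist a c ℚ.+ dist b d                 ∎
      where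
      open +-*-Solver
      eq : (a ℚ.+ b) ℚ.- (c ℚ.+ d) ≡ (a ℚ.- c) ℚ.+ (b ℚ.- d)
      eq = solve 4 (λ a b c d → (a :+ b) :- (c :+ d) := (a :- c) :+ (b :- d))
             refl a b c d

    +-cauchy : ∀ x y → Cauchy x → Cauchy y → Cauchy (λ n → x n ℚ.+ y n)
    +-cauchy x y cx cy ε ε>0
      with cx (½ ℚ.* ε) (½-pos ε ε>0) | cy (½ ℚ.* ε) (½-pos ε ε>0)
    ... | M , hx | N , hy = M ℕ.⊔ N , λ m n m≥ n≥ → begin-strict
      dist (x m ℚ.+ y m) (x n ℚ.+ y n)
        ≤⟨ dist-+ (x m) (y m) (x n) (y n) ⟩
      dist (x m) (x n) ℚ.+ dist (y m) (y n)
        <⟨ ℚ.+-mono-<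
             (hx m n (ℕ.m⊔n≤o⇒m≤o M N m≥) (ℕ.m⊔n≤o⇒m≤o M N n≥))
             (hy m n (ℕ.m⊔n≤o⇒n≤o M N m≥) (ℕ.m⊔n≤o⇒n≤o M N n≥)) ⟩
      ½ ℚ.* ε ℚ.+ ½ ℚ.* ε
        ≡⟨ halves ε ⟩
      ε ∎

    neg-cauchy : ∀ x → Cauchy x → Cauchy (λ n → ℚ.- x n)
    neg-cauchy x cx ε ε>0 with cx ε ε>0
    ... | N , hx = N , λ m n m≥ n≥ → begin-strict
      dist (ℚ.- x m) (ℚ.- x n)        ≡⟨ cong ℚ.∣_∣ (sym (ℚ.neg-distrib-+ (x m) (ℚ.- x n))) ⟩
      ℚ.∣ ℚ.- (x m ℚ.- x n) ∣         ≡⟨ ℚ.∣-p∣≡∣p∣ (x m ℚ.- x n) ⟩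
      dist (x m) (x n)                <⟨ hx m n m≥ n≥ ⟩
      ε                               ∎

    cancel : ∀ p q → (p ℚ.- q) ℚ.+ q ≡ p
    cancel = solve 2 (λ p q → (p :- q) :+ q := p) refl
      where open +-*-Solver

    cancel′ : ∀ p q → (p ℚ.+ q) ℚ.- q ≡ p
    cancel′ = solve 2 (λ p q → (p :+ q) :- q := p) refl
      where open +-*-Solver

    swap : ∀ p q → ℚ.- (p ℚ.- q) ≡ q ℚ.- p
    swap = solve 2 (λ p q → :- (p :- q) := q :- p) refl
      where open +-*-Solver

    ∣p∣-∣q∣≤ : ∀ p q → ℚ.∣ p ∣ ℚ.- ℚ.∣ q ∣ ℚ.≤ dist p q
    ∣p∣-∣q∣≤ p q = begin
      ℚ.∣ p ∣ ℚ.- ℚ.∣ q ∣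
        ≡⟨ cong (λ r → ℚ.∣ r ∣ ℚ.- ℚ.∣ q ∣) (sym (cancel p q)) ⟩
      ℚ.∣ (p ℚ.- q) ℚ.+ q ∣ ℚ.- ℚ.∣ q ∣
        ≤⟨ ℚ.+-monoˡ-≤ (ℚ.- ℚ.∣ q ∣) (ℚ.∣p+q∣≤∣p∣+∣q∣ (p ℚ.- q) q) ⟩
      (dist p q ℚ.+ ℚ.∣ q ∣) ℚ.- ℚ.∣ q ∣
        ≡⟨ cancel′ (dist p q) ℚ.∣ q ∣ ⟩
      dist p q ∎

    dist-∣∣ : ∀ p q → dist ℚ.∣ p ∣ ℚ.∣ q ∣ ℚ.≤ dist p q
    dist-∣∣ p q with ℚ.∣p∣≡p∨∣p∣≡-p (ℚ.∣ p ∣ ℚ.- ℚ.∣ q ∣)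
    ... | inj₁ eq = subst (ℚ._≤ dist p q) (sym eq) (∣p∣-∣q∣≤ p q)
    ... | inj₂ eq = begin
      dist ℚ.∣ p ∣ ℚ.∣ q ∣          ≡⟨ eq ⟩
      ℚ.- (ℚ.∣ p ∣ ℚ.- ℚ.∣ q ∣)     ≡⟨ swap ℚ.∣ p ∣ ℚ.∣ q ∣ ⟩
      ℚ.∣ q ∣ ℚ.- ℚ.∣ p ∣           ≤⟨ ∣p∣-∣q∣≤ q p ⟩
      dist q p                      ≡⟨ cong ℚ.∣_∣ (sym (swap p q)) ⟩
      ℚ.∣ ℚ.- (p ℚ.- q) ∣           ≡⟨ ℚ.∣-p∣≡∣p∣ (p ℚ.- q) ⟩
      dist p q                      ∎

    abs-cauchy : ∀ x → Cauchy x → Cauchy (λ n → ℚ.∣ x n ∣)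
    abs-cauchy x cx ε ε>0 with cx ε ε>0
    ... | N , hx = N , λ m n m≥ n≥ →
      ℚ.≤-<-trans (dist-∣∣ (x m) (x n)) (hx m n m≥ n≥)

    bounded : ∀ x → Cauchy x →
      ∃[ K ] (0ℚ ℚ.< K × ∃[ N ] (∀ n → N ℕ.≤ n → ℚ.∣ x n ∣ ℚ.< K))
    bounded x cx with cx 1ℚ (ℚ.positive⁻¹ 1ℚ)
    ... | N , hx = 1ℚ ℚ.+ ℚ.∣ x N ∣
                 , ℚ.+-mono-<-≤ (ℚ.positive⁻¹ 1ℚ) (ℚ.0≤∣p∣ (x N))
                 , N , λ n n≥ → begin-strict
      ℚ.∣ x n ∣                        ≡⟨ cong ℚ.∣_∣ (sym (cancel (x n) (x N))) ⟩
      ℚ.∣ (x n ℚ.- x N) ℚ.+ x N ∣      ≤⟨ ℚ.∣p+q∣≤∣p∣+∣q∣ (x n ℚ.- x N) (x N) ⟩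
      dist (x n) (x N) ℚ.+ ℚ.∣ x N ∣   <⟨ ℚ.+-monoˡ-< ℚ.∣ x N ∣ (hx n N n≥ ℕ.≤-refl) ⟩
      1ℚ ℚ.+ ℚ.∣ x N ∣                 ∎

    dist-* : ∀ a b c d →
      dist (a ℚ.* b) (c ℚ.* d) ℚ.≤ ℚ.∣ a ∣ ℚ.* dist b d ℚ.+ ℚ.∣ d ∣ ℚ.* dist a c
    dist-* a b c d = begin
      dist (a ℚ.* b) (c ℚ.* d)
        ≡⟨ cong ℚ.∣_∣ eq ⟩
      ℚ.∣ a ℚ.* (b ℚ.- d) ℚ.+ d ℚ.* (a ℚ.- c) ∣
        ≤⟨ ℚ.∣p+q∣≤∣p∣+∣q∣ (a ℚ.* (b ℚ.- d)) (d ℚ.* (a ℚ.- c)) ⟩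
      ℚ.∣ a ℚ.* (b ℚ.- d) ∣ ℚ.+ ℚ.∣ d ℚ.* (a ℚ.- c) ∣
        ≡⟨ cong₂ ℚ._+_ (ℚ.∣p*q∣≡∣p∣*∣q∣ a (b ℚ.- d)) (ℚ.∣p*q∣≡∣p∣*∣q∣ d (a ℚ.- c)) ⟩
      ℚ.∣ a ∣ ℚ.* dist b d ℚ.+ ℚ.∣ d ∣ ℚ.* dist a c ∎
      where
      open +-*-Solver
      eq : (a ℚ.* b) ℚ.- (c ℚ.* d) ≡ a ℚ.* (b ℚ.- d) ℚ.+ d ℚ.* (a ℚ.- c)
      eq = solve 4 (λ a b c d →
             (a :* b) :- (c :* d) := a :* (b :- d) :+ d :* (a :- c))
             refl a b c d

    *-bound : ∀ p q {K δ} → 0ℚ ℚ.< δ → ℚ.∣ p ∣ ℚ.< K → ℚ.∣ q ∣ ℚ.< δ →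
      ℚ.∣ p ∣ ℚ.* ℚ.∣ q ∣ ℚ.< K ℚ.* δ
    *-bound p q {K} {δ} δ>0 p<K q<δ = begin-strict
      ℚ.∣ p ∣ ℚ.* ℚ.∣ q ∣
        ≤⟨ ℚ.*-monoˡ-≤-nonNeg ℚ.∣ p ∣ {{ℚ.∣-∣-nonNeg p}} (ℚ.<⇒≤ q<δ) ⟩
      ℚ.∣ p ∣ ℚ.* δ
        <⟨ ℚ.*-monoˡ-<-pos δ {{ℚ.positive δ>0}} p<K ⟩
      K ℚ.* δ ∎

    quotient : ∀ K ε → 0ℚ ℚ.< K → 0ℚ ℚ.< ε → ∃[ δ ] (0ℚ ℚ.< δ × K ℚ.* δ ≡ ε)
    quotient K ε K>0 ε>0 =
      K⁻¹ ℚ.* ε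
      , ℚ.positive⁻¹ (K⁻¹ ℚ.* ε) {{ℚ.pos*pos⇒pos K⁻¹ {{ℚ.1/pos⇒pos K}} ε {{ℚ.positive ε>0}}}}
      , trans (sym (ℚ.*-assoc K K⁻¹ ε))
          (trans (cong (ℚ._* ε) (ℚ.*-inverseʳ K)) (ℚ.*-identityˡ ε))
      where
      instance
        K-pos : ℚ.Positive K
        K-pos = ℚ.positive K>0
        K-nonZero : ℚ.NonZero K
        K-nonZero = ℚ.pos⇒nonZero K
      K⁻¹ = ℚ.1/ K

    *-estimate : ∀ a b c d {K L δ} → 0ℚ ℚ.< δ → ℚ.∣ a ∣ ℚ.< K → ℚ.∣ d ∣ ℚ.< L →
      dist a c ℚ.< δ → dist b d ℚ.< δ →
      dist (a ℚ.* b) (c ℚ.* d) ℚ.< (K ℚ.+ L) ℚ.* δ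
    *-estimate a b c d {K} {L} {δ} δ>0 a<K d<L ac<δ bd<δ = begin-strict
      dist (a ℚ.* b) (c ℚ.* d)
        ≤⟨ dist-* a b c d ⟩
      ℚ.∣ a ∣ ℚ.* dist b d ℚ.+ ℚ.∣ d ∣ ℚ.* dist a c
        <⟨ ℚ.+-mono-< (*-bound a (b ℚ.- d) δ>0 a<K bd<δ)
                      (*-bound d (a ℚ.- c) δ>0 d<L ac<δ) ⟩
      K ℚ.* δ ℚ.+ L ℚ.* δ
        ≡⟨ sym (ℚ.*-distribʳ-+ δ K L) ⟩
      (K ℚ.+ L) ℚ.* δ ∎

    *-cauchy : ∀ x y → Cauchy x → Cauchy y → Cauchy (λ n → x n ℚ.* y n)
    *-cauchy x y cx cy ε ε>0 =
      let K , K>0 , N₁ , bx = bounded x cx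
          L , L>0 , N₂ , by = bounded y cy
          δ , δ>0 , eq = quotient (K ℚ.+ L) ε (ℚ.+-mono-< K>0 L>0) ε>0
          N₃ , hx = cx δ δ>0
          N₄ , hy = cy δ δ>0
          M₁ = N₁ ℕ.⊔ N₂
          M₂ = N₃ ℕ.⊔ N₄
      in M₁ ℕ.⊔ M₂ , λ m n m≥ n≥ →
        let m≥₁ = ℕ.m⊔n≤o⇒m≤o M₁ M₂ m≥
            m≥₂ = ℕ.m⊔n≤o⇒n≤o M₁ M₂ m≥
            n≥₁ = ℕ.m⊔n≤o⇒m≤o M₁ M₂ n≥
            n≥₂ = ℕ.m⊔n≤o⇒n≤o M₁ M₂ n≥
        in subst (dist (x m ℚ.* y m) (x n ℚ.* y n) ℚ.<_) eq
             (*-estimate (x m) (y m) (x n) (y n) δ>0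
               (bx m (ℕ.m⊔n≤o⇒m≤o N₁ N₂ m≥₁))
               (by n (ℕ.m⊔n≤o⇒n≤o N₁ N₂ n≥₁))
               (hx m n (ℕ.m⊔n≤o⇒m≤o N₃ N₄ m≥₂) (ℕ.m⊔n≤o⇒m≤o N₃ N₄ n≥₂))
               (hy m n (ℕ.m⊔n≤o⇒n≤o N₃ N₄ m≥₂) (ℕ.m⊔n≤o⇒n≤o N₃ N₄ n≥₂)))

  open Cauchyness

infix  8 -_
infixl 7 _*_
infixl 6 _+_ _-_
infix  9 _²

fromℚ : ℚ → ℝ
fromℚ q = mkℝ (λ _ → q) (const-cauchy q)

0ℝ 2ℝ : ℝ
0ℝ = fromℚ 0ℚ
2ℝ = fromℚ (1ℚ ℚ.+ 1ℚ)

-_ ∣_∣ : ℝ → ℝ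
- x   = mkℝ (λ n → ℚ.- seq x n) (neg-cauchy (seq x) (cauchy x))
∣ x ∣ = mkℝ (λ n → ℚ.∣ seq x n ∣) (abs-cauchy (seq x) (cauchy x))

_+_ _*_ _-_ : ℝ → ℝ → ℝ
x + y = mkℝ (λ n → seq x n ℚ.+ seq y n) (+-cauchy (seq x) (seq y) (cauchy x) (cauchy y))
x * y = mkℝ (λ n → seq x n ℚ.* seq y n) (*-cauchy (seq x) (seq y) (cauchy x) (cauchy y))
x - y = x + (- y)

_² : ℝ → ℝ
x ² = x * x

k₀ : ℤ → ℕ
k₀ (ℤ.+ _)      = 0
k₀ ℓ@(-[1+ _ ]) = ℤ.∣ ℓ ∣

-- The integer 2k + ℓ as a row number: for k ≥ k₀ it is nonnegative, so
-- ∣_∣ does not change it (row-exact).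
row : ℤ → ℕ → ℕ
row ℓ k = ℤ.∣ ℤ.+ (2 ℕ.* k) ℤ.+ ℓ ∣

private
  neg-row : ∀ n k → suc n ℕ.≤ k →
    ℤ.+ (2 ℕ.* k) ℤ.+ -[1+ n ] ≡ ℤ.+ (2 ℕ.* k ℕ.∸ suc n)
  neg-row n k n<k = ℤ.⊖-≥ (ℕ.≤-trans n<k (ℕ.m≤m+n k _))

row-exact : ∀ ℓ k → k₀ ℓ ℕ.≤ k → ℤ.+ row ℓ k ≡ ℤ.+ (2 ℕ.* k) ℤ.+ ℓ
row-exact (ℤ.+ _)  k h = refl
row-exact -[1+ n ] k h =
  trans (cong (λ i → ℤ.+ ℤ.∣ i ∣) (neg-row n k h)) (sym (neg-row n k h))

k≤row : ∀ ℓ k → k₀ ℓ ℕ.≤ k → k ℕ.≤ row ℓ k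
k≤row (ℤ.+ l)  k h = ℕ.≤-trans (ℕ.m≤m+n k _) (ℕ.m≤m+n (2 ℕ.* k) l)
k≤row -[1+ n ] k h =
  subst (k ℕ.≤_) (sym (cong ℤ.∣_∣ (neg-row n k h))) (begin
    k                     ≡⟨ sym (ℕ.m+n∸n≡m k k) ⟩
    k ℕ.+ k ℕ.∸ k         ≤⟨ ℕ.∸-monoʳ-≤ (k ℕ.+ k) h ⟩
    k ℕ.+ k ℕ.∸ suc n     ≡⟨ cong (λ j → k ℕ.+ j ℕ.∸ suc n) (sym (ℕ.+-identityʳ k)) ⟩
    2 ℕ.* k ℕ.∸ suc n     ∎)
  where open ℕ.≤-Reasoning

module Triangle (a₀ a₁ α β u v : ℝ) where

  left : ℕ → ℝ
  left zero          = a₀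
  left (suc zero)    = a₁
  left (suc (suc n)) = α * left (suc n) + β * left n

  -- Only defined for k ≤ n; the bound is irrelevant, so the value does not
  -- depend on how it is proved.
  entry : (n k : ℕ) → .(k ℕ.≤ n) → ℝ
  entry n       zero    _   = left n
  entry (suc n) (suc k) k≤n =
    u * entry (suc n) k (ℕ.m≤n⇒m≤1+n (ℕ.s≤s⁻¹ k≤n)) + v * entry n k (ℕ.s≤s⁻¹ k≤n)

  𝓑 : ℝ
  𝓑 = u ² * β - u * v * α - v ²

  c : (ℓ : ℤ) (k : ℕ) → .(k₀ ℓ ℕ.≤ k) → ℝ
  c ℓ k h = entry (row ℓ k) k (k≤row ℓ k h)

{-# OPTIONS --safe #-}
-- For a left diagonal λⁿ with λ² = α λ + β the entries are
-- a(n,k) = λⁿ⁻ᵏ (u λ + v)ᵏ, so c(k) = λ^ℓ (λ (u λ + v))ᵏ, and the two values of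
-- λ (u λ + v) have sum α² u + α v + 2 β u and product β 𝓑.  To avoid the roots
-- λ: every column inherits the recurrence of the left diagonal, so a(n+4,k+2),
-- a(n+2,k+1) and a(n,k) are all combinations of a(n+1,k) and a(n,k), and the
-- claim is a polynomial identity.
module Submission where

open import Defs
open import Data.Nat.Base as ℕ using (ℕ; zero; suc; _≤_; s≤s⁻¹)
open import Data.Nat.Properties using (m≤n⇒m≤1+n; *-suc)
open import Data.Integer.Base as ℤ using (ℤ)
import Data.Integer.Properties as ℤ
open import Data.Product.Base using (_,_)
open import Data.Rational.Base as ℚ using (0ℚ; 1ℚ)
import Data.Rational.Properties as ℚ
open import Data.Rational.Solver using (module +-*-Solver)
open import Relation.Binary.PropositionalEquality
  using (_≡_; refl; sym; trans; cong; cong₂; subst; module ≡-Reasoning)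
open import Relation.Nullary.Negation.Core using (¬_)

infix 4 _≐_

-- The ring operations act termwise on Cauchy sequences, so the ring identities
-- hold termwise, which is easier to handle than _≈_.
_≐_ : ℝ → ℝ → Set
x ≐ y = ∀ i → seq x i ≡ seq y i

≐⇒≈ : ∀ {x y} → x ≐ y → x ≈ y
≐⇒≈ {x} {y} x≐y ε ε>0 = 0 , λ i _ → subst (ℚ._< ε) (sym (distance i)) ε>0
  where
  distance : ∀ i → ℚ.∣ seq x i ℚ.- seq y i ∣ ≡ 0ℚ
  distance i = cong ℚ.∣_∣
    (trans (cong (ℚ._- seq y i) (x≐y i)) (ℚ.+-inverseʳ (seq y i)))

-- The absolute value in `row` blocks a direct computation, so the equation is proved in ℤ, where
-- `row-exact` removes it.
row-suc : ∀ ℓ k → k₀ ℓ ≤ k → row ℓ (suc k) ≡ 2 ℕ.+ row ℓ k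
row-suc ℓ k k≥k₀ = ℤ.+-injective (begin
  ℤ.+ row ℓ (suc k)                ≡⟨ row-exact ℓ (suc k) (m≤n⇒m≤1+n k≥k₀) ⟩
  ℤ.+ (2 ℕ.* suc k) ℤ.+ ℓ          ≡⟨ cong (λ j → ℤ.+ j ℤ.+ ℓ) (*-suc 2 k) ⟩
  ℤ.+ 2 ℤ.+ ℤ.+ (2 ℕ.* k) ℤ.+ ℓ    ≡⟨ ℤ.+-assoc (ℤ.+ 2) (ℤ.+ (2 ℕ.* k)) ℓ ⟩
  ℤ.+ 2 ℤ.+ (ℤ.+ (2 ℕ.* k) ℤ.+ ℓ)  ≡⟨ cong (λ i → ℤ.+ 2 ℤ.+ i) (sym (row-exact ℓ k k≥k₀)) ⟩
  ℤ.+ (2 ℕ.+ row ℓ k)              ∎)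
  where open ≡-Reasoning

recurrence-combine : ∀ α β u v p q r s →
  u ℚ.* (α ℚ.* p ℚ.+ β ℚ.* q) ℚ.+ v ℚ.* (α ℚ.* r ℚ.+ β ℚ.* s)
    ≡ α ℚ.* (u ℚ.* p ℚ.+ v ℚ.* r) ℚ.+ β ℚ.* (u ℚ.* q ℚ.+ v ℚ.* s)
recurrence-combine = solve 8 (λ α β u v p q r s →
  u :* (α :* p :+ β :* q) :+ v :* (α :* r :+ β :* s)
    := α :* (u :* p :+ v :* r) :+ β :* (u :* q :+ v :* s)) refl
  where open +-*-Solver

-- Here `x₀` to `x₄` stand for a(n,k) to a(n+4,k). The left side is a(n+4,k+2) with the triangle
-- rule applied twice, and `u x₂ + v x₁` is a(n+2,k+1).
diagonal-identity : ∀ α β u v x₀ x₁ {x₂ x₃ x₄} →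
  x₂ ≡ α ℚ.* x₁ ℚ.+ β ℚ.* x₀ →
  x₃ ≡ α ℚ.* x₂ ℚ.+ β ℚ.* x₁ →
  x₄ ≡ α ℚ.* x₃ ℚ.+ β ℚ.* x₂ →
  u ℚ.* (u ℚ.* x₄ ℚ.+ v ℚ.* x₃) ℚ.+ v ℚ.* (u ℚ.* x₃ ℚ.+ v ℚ.* x₂)
    ≡ (α ℚ.* α ℚ.* u ℚ.+ α ℚ.* v ℚ.+ (1ℚ ℚ.+ 1ℚ) ℚ.* β ℚ.* u)
        ℚ.* (u ℚ.* x₂ ℚ.+ v ℚ.* x₁)
      ℚ.- β ℚ.* (u ℚ.* u ℚ.* β ℚ.- u ℚ.* v ℚ.* α ℚ.- v ℚ.* v) ℚ.* x₀
diagonal-identity α β u v x₀ x₁ refl refl refl = solve 6 (λ α β u v x₀ x₁ →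
  let x₂ = α :* x₁ :+ β :* x₀
      x₃ = α :* x₂ :+ β :* x₁
      x₄ = α :* x₃ :+ β :* x₂
  in u :* (u :* x₄ :+ v :* x₃) :+ v :* (u :* x₃ :+ v :* x₂)
    := (α :* α :* u :+ α :* v :+ con (1ℚ ℚ.+ 1ℚ) :* β :* u)
         :* (u :* x₂ :+ v :* x₁)
       :- β :* (u :* u :* β :- u :* v :* α :- v :* v) :* x₀) refl α β u v x₀ x₁
  where open +-*-Solver

module _ (a₀ a₁ α β u v : ℝ) where
  open Triangle a₀ a₁ α β u v

  -- Induction on `k`: column k+1 is a fixed linear combination of column k and its shift by one
  -- row, and a linear recurrence survives both operations.
  column-recurrence : ∀ n k .(k≤n : k ≤ n) →
    entry (2 ℕ.+ n) k (m≤n⇒m≤1+n (m≤n⇒m≤1+n k≤n))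
      ≐ α * entry (suc n) k (m≤n⇒m≤1+n k≤n) + β * entry n k k≤n
  column-recurrence n       zero    _   i = refl
  column-recurrence (suc n) (suc k) k≤n i = trans
    (cong₂ (λ p q → seq u i ℚ.* p ℚ.+ seq v i ℚ.* q)
      (column-recurrence (suc n) k (m≤n⇒m≤1+n (s≤s⁻¹ k≤n)) i)
      (column-recurrence n k (s≤s⁻¹ k≤n) i))
    (recurrence-combine (seq α i) (seq β i) (seq u i) (seq v i) _ _ _ _)

  -- The rows `n₁` and `n₂` are variables with equations because `row ℓ (suc k)` does not reduce to
  -- `2 + row ℓ k`. Matching on `refl` then lets the entries unfold, and irrelevance of the bounds
  -- spares any transport of their proofs.
  diagonal-recurrence : ∀ n {n₁ n₂} k → n₁ ≡ 2 ℕ.+ n → n₂ ≡ 4 ℕ.+ n →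
    .(k≤n : k ≤ n) .(1+k≤n₁ : suc k ≤ n₁) .(2+k≤n₂ : 2 ℕ.+ k ≤ n₂) →
    entry n₂ (2 ℕ.+ k) 2+k≤n₂
      ≐ (α ² * u + α * v + 2ℝ * β * u) * entry n₁ (suc k) 1+k≤n₁
        - β * 𝓑 * entry n k k≤n
  diagonal-recurrence n k refl refl k≤n _ _ i =
    diagonal-identity (seq α i) (seq β i) (seq u i) (seq v i) _ _
      (column-recurrence n k k≤n i)
      (column-recurrence (suc n) k (m≤n⇒m≤1+n k≤n) i)
      (column-recurrence (2 ℕ.+ n) k (m≤n⇒m≤1+n (m≤n⇒m≤1+n k≤n)) i)

theorem10 : (a₀ a₁ α β u v : ℝ) →
    ¬ (α * β ≈ 0ℝ) → ¬ (u * v ≈ 0ℝ) → ¬ (∣ a₀ ∣ + ∣ a₁ ∣ ≈ 0ℝ) →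
    let open Triangle a₀ a₁ α β u v in
    (ℓ : ℤ) (k : ℕ) (k≥k₀ : k₀ ℓ ≤ k) →
    c ℓ (suc (suc k)) (m≤n⇒m≤1+n (m≤n⇒m≤1+n k≥k₀))
      ≈ (α ² * u + α * v + 2ℝ * β * u) * c ℓ (suc k) (m≤n⇒m≤1+n k≥k₀)
        - β * 𝓑 * c ℓ k k≥k₀
theorem10 a₀ a₁ α β u v _ _ _ ℓ k k≥k₀ =
  ≐⇒≈ {c ℓ (2 ℕ.+ k) k+2≥k₀}
      {(α ² * u + α * v + 2ℝ * β * u) * c ℓ (suc k) k+1≥k₀ - β * 𝓑 * c ℓ k k≥k₀}
      (diagonal-recurrence a₀ a₁ α β u v (row ℓ k) k
        row₁ (trans (row-suc ℓ (suc k) k+1≥k₀) (cong (2 ℕ.+_) row₁))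
        (k≤row ℓ k k≥k₀) (k≤row ℓ (suc k) k+1≥k₀) (k≤row ℓ (2 ℕ.+ k) k+2≥k₀))
  where
  open Triangle a₀ a₁ α β u v

  k+1≥k₀ : k₀ ℓ ≤ suc k
  k+1≥k₀ = m≤n⇒m≤1+n k≥k₀

  k+2≥k₀ : k₀ ℓ ≤ 2 ℕ.+ k
  k+2≥k₀ = m≤n⇒m≤1+n k+1≥k₀

  row₁ : row ℓ (suc k) ≡ 2 ℕ.+ row ℓ k
  row₁ = row-suc ℓ k k≥k₀
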